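{- The Lempel-Ziv 77 factorization without self-references ($\mathsf{LZN}$, with size $\mathsf{zn}$) is non-monotonic, and the Lempel-Ziv 77 factorization with self-references ($\mathsf{LZS}$, with size $\mathsf{zs}$) is non-monotonic.
   Context: Strings are indexed from $1$; they are over arbitrary finite alphabets (no bound on the alphabet size). $S[i..j]$ is the substring from position $i$ to $j$ (empty if $j<i$), and $S[i..]=S[i..|S|]$. $\mathsf{lcp}(X,Y)$ is the length of the longest common prefix of $X$ and $Y$. Monotonicity: for a compression algorithm $\mathsf{A}$ let $\mathsf{A}(S)$ be the size of its compressed representation of $S$. $\mathsf{A}$ is monotonic if for every string $S$: $\mathsf{A}(S[1..j])\le \mathsf{A}(S)$ for all $1\le j<|S|$ and $\mathsf{A}(S[i..|S|])\le\mathsf{A}(S)$ for all $1<i\le|S|$. It is non-monotonic otherwise. Non self-referencing LZ77: $\mathsf{LZN}(S)$ is the factorization $S=f_1\cdots f_{z}$ defined greedily from left to right: with $u_i=|f_1\cdots f_{i-1}|+1$ and $p_i=\max_{1\le j<u_i}\mathsf{lcp}(S[u_i..],S[j..u_i-1])$ ($p_i=0$ if $i=1$), set $f_i=S[u_i..\min\{u_i+p_i,|S|\}]$. Its size $\mathsf{zn}(S)$ is the number of factors. Self-referencing LZ77: $\mathsf{LZS}(S)$ is the factorization $S=g_1\cdots g_{z'}$ defined greedily from left to right: with $v_i=|g_1\cdots g_{i-1}|+1$ and $q_i=\max_{1\le j<v_i}\mathsf{lcp}(S[v_i..],S[j..])$ ($q_i=0$ if $i=1$), set $g_i=S[v_i..\min\{v_i+q_i,|S|\}]$.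 Its size $\mathsf{zs}(S)$ is the number of factors. -}

module Defs where

open import Data.Bool.Base using (if_then_else_)
open import Data.Fin.Base using (Fin)
open import Data.Fin.Properties using (_≟_)
open import Data.List.Base
  using (List; []; _∷_; _++_; length; take; drop; map; upTo; concat)
open import Data.List.Extrema.Nat using (max)
open import Data.List.Properties
  using (take++drop≡id; drop-all)
open import Data.Nat.Base
  using (ℕ; zero; suc; _+_; _∸_; _⊓_; _≤_; _<_; z≤n; s≤s)
open import Data.Nat.Properties
  using (_≤?_; ≮⇒≥; <⇒≤; ⊓-glb; m≤m+n; ≤-trans; ≤-reflexive; +-suc; +-monoʳ-≤)
open import Data.Product.Base using (_×_)
open import Relation.Binary.PropositionalEquality
  using (_≡_; refl; sym; trans; cong)
open import Relation.Nullary.Decidable.Core using (yes; no; does)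
open import Relation.Nullary.Negation.Core using (¬_)

String : ℕ → Set
String σ = List (Fin σ)

private
  variable
    σ : ℕ

-- Positions are 1-based, and both ends are inclusive.
_[_⋯_] : String σ → ℕ → ℕ → String σ
S [ i ⋯ j ] = drop (i ∸ 1) (take j S)

_[_⋯] : String σ → ℕ → String σ
S [ i ⋯] = S [ i ⋯ length S ]

lcp : String σ → String σ → ℕ
lcp []      _       = 0
lcp (_ ∷ _) []      = 0
lcp (x ∷ X) (y ∷ Y) = if does (x ≟ y) then suc (lcp X Y) else 0

-- The maximum of f j over 1 ≤ j < u, and 0 if there is no such j.
max[1≤j<_] : ℕ → (ℕ → ℕ) → ℕ
max[1≤j< u ] f = max 0 (map (λ k → f (suc k)) (upTo (u ∸ 1)))

longestPreviousN : String σ → ℕ → ℕ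
longestPreviousN S u = max[1≤j< u ] λ j → lcp (S [ u ⋯]) (S [ j ⋯ u ∸ 1 ])

longestPreviousS : String σ → ℕ → ℕ
longestPreviousS S v = max[1≤j< v ] λ j → lcp (S [ v ⋯]) (S [ j ⋯])

-- The factors of S from position u on, where p u is the length of the
-- previously occurring part of a factor starting at u.  The first argument
-- bounds the number of factors; it is there only for termination.
greedyFrom : ℕ → (ℕ → ℕ) → String σ → ℕ → List (String σ)
greedyFrom zero    p S u = []
greedyFrom (suc n) p S u with u ≤? length S
... | no  _ = []
... | yes _ = S [ u ⋯ e ] ∷ greedyFrom n p S (suc e)
  where e = (u + p u) ⊓ length S

-- Factors are nonempty, so there are at most length S of them
-- (see concat-greedy).
greedy : (ℕ → ℕ) → String σ → List (String σ)
greedy p S = greedyFrom (length S) p S 1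

LZN : String σ → List (String σ)
LZN S = greedy (longestPreviousN S) S

LZS : String σ → List (String σ)
LZS S = greedy (longestPreviousS S) S

zn : String σ → ℕ
zn S = length (LZN S)

zs : String σ → ℕ
zs S = length (LZS S)

Monotonic : (∀ {σ} → String σ → ℕ) → Set
Monotonic A = ∀ {σ} (S : String σ) →
  (∀ j → 1 ≤ j → j < length S → A (S [ 1 ⋯ j ]) ≤ A S) ×
  (∀ i → 1 < i → i ≤ length S → A (S [ i ⋯ length S ]) ≤ A S)

NonMonotonic : (∀ {σ} → String σ → ℕ) → Set
NonMonotonic A = ¬ Monotonic A

private
  slice-++-drop : ∀ (S : String σ) {k e} → k ≤ e →
                  drop k (take e S) ++ drop e S ≡ drop k S
  slice-++-drop S       {e = e} z≤n       = take++drop≡id e S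
  slice-++-drop []              (s≤s k≤e) = refl
  slice-++-drop (_ ∷ S)         (s≤s k≤e) = slice-++-drop S k≤e

  concat-greedyFrom : ∀ n p (S : String σ) k → length S ≤ n + k →
                      concat (greedyFrom n p S (suc k)) ≡ drop k S
  concat-greedyFrom zero    p S k |S|≤k = sym (drop-all k S |S|≤k)
  concat-greedyFrom (suc n) p S k |S|≤n+k with suc k ≤? length S
  ... | no  k≮|S| = sym (drop-all k S (≮⇒≥ k≮|S|))
  ... | yes k<|S| =
    trans (cong (S [ suc k ⋯ e ] ++_) (concat-greedyFrom n p S e |S|≤n+e))
          (slice-++-drop S (<⇒≤ k<e))
    where
    e = (suc k + p (suc k)) ⊓ length S
    k<e : k < e
    k<e = ⊓-glb (m≤m+n (suc k) (p (suc k))) k<|S|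
    |S|≤n+e : length S ≤ n + e
    |S|≤n+e = ≤-trans (≤-trans |S|≤n+k (≤-reflexive (sym (+-suc n k)))) (+-monoʳ-≤ n k<e)

concat-greedy : ∀ p (S : String σ) → concat (greedy p S) ≡ S
concat-greedy p S = concat-greedyFrom (length S) p S 0 (m≤m+n (length S) 0)

{-# OPTIONS --safe #-}
-- The string S = aabaaa is factored as a|ab|aaa in both variants.  Without its
-- first letter it is abaaa, in which aa no longer occurs before the final aaa:
-- both variants factor it as a|b|aa|a, with one factor more.
module Submission where

open import Defs
open import Data.Fin.Patterns using (0F; 1F)
open import Data.List.Base using ([]; _∷_)
open import Data.Nat.Base using (ℕ; _<_)
open import Data.Nat.Properties using (_≤?_; _<?_; ≤⇒≯)
open import Data.Product.Base using (_×_; _,_; proj₂)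
open import Relation.Nullary.Decidable.Core using (from-yes)

aabaaa : String 2
aabaaa = 0F ∷ 0F ∷ 1F ∷ 0F ∷ 0F ∷ 0F ∷ []

-- The suffix half of monotonicity already fails at this one string. `A` stays abstract because the
-- same witness serves both factorizations.
larger-suffix⇒nonMonotonic : (A : ∀ {σ} → String σ → ℕ) →
                             A aabaaa < A (aabaaa [ 2 ⋯]) → NonMonotonic A
larger-suffix⇒nonMonotonic A A[S]<A[S[2⋯]] mono =
  -- Start 2 drops exactly the first letter; 6 is the length of `aabaaa`.
  ≤⇒≯ (proj₂ (mono aabaaa) 2 (from-yes (1 <? 2)) (from-yes (2 ≤? 6))) A[S]<A[S[2⋯]]

corollary1 : NonMonotonic zn × NonMonotonic zs
corollary1 =
  -- Both sizes are closed terms, so type checking evaluates the factorizations and decides 3 < 4,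
  -- here and for `zs`.
  larger-suffix⇒nonMonotonic zn (from-yes (zn aabaaa <? zn (aabaaa [ 2 ⋯]))) ,
  larger-suffix⇒nonMonotonic zs (from-yes (zs aabaaa <? zs (aabaaa [ 2 ⋯])))
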